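{- Let $G$ be a finite simple undirected graph, and let $c:V(G)\to \mathbb{R}_{>0}$ and $\kappa:V(G)\to \mathbb{Z}$ be functions such that $0\leq \kappa(u)\leq d_G(u)$ for every vertex $u$ of $G$. Then $$\beta(G,c,\kappa) \leq \sum_{u\in V(G)} \frac{c(u)\big(d_G(u)-\kappa(u)\big)\big(d_G(u)-\kappa(u)+1\big)}{2(d_G(u)+1)}.$$
   Context: $d_G(u)$ denotes the degree of $u$ in $G$, and $[n]=\{1,\dots,n\}$. For a function $\lambda:V(G)\to\mathbb{Z}$, a set $I\subseteq V(G)$ is called $\lambda$-degenerate in $G$ if there is a linear ordering $u_1,\ldots,u_k$ of the vertices of $I$ such that for every $i\in[k]$, $u_i$ has at most $\lambda(u_i)$ neighbors in $\{u_j: j\in[i-1]\}$. Define $$\beta(G,c,\kappa)=\min\Big\{\sum_{u\in V(G)} c(u)\iota(u) : \iota:V(G)\to\mathbb{Z}_{\geq 0} \text{ and } V(G) \text{ is } (\kappa+\iota)\text{ -degenerate in } G\Big\}.$$ -}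

module Defs where

open import Data.Fin.Base using (Fin; zero; suc; toℕ)
import Data.Fin.Properties as Finₚ
open import Data.Fin.Subset using (Subset; ⊤) renaming (_∈_ to _∈ₛ_)
open import Data.Fin.Subset.Properties using (∈⊤)
open import Data.Integer.Base as ℤ using (ℤ; +_; -[1+_])
import Data.Integer.Properties as ℤₚ
open import Data.List.Base using (List; []; _∷_; length; filter; take; lookup; allFin; upTo; cartesianProduct; cartesianProductWith)
open import Data.List.Membership.Propositional using (_∈_)
open import Data.List.Membership.Propositional.Properties using (∈-cartesianProduct⁺; ∈-cartesianProductWith⁺; ∈-filter⁺; ∈-filter⁻; ∈-upTo⁺; ∈-allFin; ∈-lookup)
import Data.List.Properties as Listₚ
import Data.List.Membership.DecPropositional as DecMembership
import Data.List.Relation.Unary.All as All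
import Data.List.Relation.Unary.AllPairs as AllPairs
open import Data.List.Relation.Unary.Any using (here; there)
open import Data.List.Relation.Unary.Unique.Propositional using (Unique)
import Data.List.Relation.Unary.Unique.Propositional.Properties as Uniqueₚ
import Data.List.Relation.Unary.Unique.DecPropositional as DecUnique
open import Data.Nat.Base as ℕ using (ℕ; zero; suc)
import Data.Nat.Properties as ℕₚ
open import Data.Product.Base using (Σ; ∃; _×_; _,_; proj₁; proj₂)
open import Data.Rational.Base as ℚ using (ℚ; 0ℚ; 1ℚ; ½)
import Data.Rational.Properties as ℚₚ
import Data.Rational.Unnormalised.Base as ℚᵘ
import Data.Rational.Unnormalised.Properties as ℚᵘₚ
open import Data.Rational.Solver using (module +-*-Solver)
open import Data.Sum.Base using (inj₁; inj₂)
open import Data.Vec.Base as Vec using (Vec; []; _∷_)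
import Data.Vec.Functional as Vector
import Data.Vec.Properties as Vecₚ
open import Function.Base using (_∘_; case_of_)
open import Function.Bundles using (_⇔_; mk⇔; Equivalence)
open import Level using (0ℓ)
open import Relation.Binary.Core using (Rel)
open import Relation.Binary.Definitions using (Decidable; Symmetric)
open import Relation.Binary.PropositionalEquality
open import Relation.Nullary using (¬_; Dec; yes; no; contradiction)
open import Relation.Nullary.Decidable using (_×-dec_; map′)

open +-*-Solver using (solve; _:+_; _:*_; :-_; _:=_)

halves : ∀ ε → ½ ℚ.* ε ℚ.+ ½ ℚ.* ε ≡ ε
halves ε = trans (sym (ℚₚ.*-distribʳ-+ ε ½ ½)) (ℚₚ.*-identityˡ ε)

half>0 : ∀ {ε} → 0ℚ ℚ.< ε → 0ℚ ℚ.< ½ ℚ.* ε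
half>0 {ε} p = subst (ℚ._< ½ ℚ.* ε) (ℚₚ.*-zeroʳ ½) (ℚₚ.*-monoʳ-<-pos ½ p)

p≤∣p∣ : ∀ p → p ℚ.≤ ℚ.∣ p ∣
p≤∣p∣ p with ℚₚ.≤-total 0ℚ p
... | inj₁ 0≤p = ℚₚ.≤-reflexive (sym (ℚₚ.0≤p⇒∣p∣≡p 0≤p))
... | inj₂ p≤0 = ℚₚ.≤-trans p≤0 (ℚₚ.0≤∣p∣ p)

∣-∣-sym : ∀ p q → ℚ.∣ p ℚ.- q ∣ ≡ ℚ.∣ q ℚ.- p ∣
∣-∣-sym p q = trans (sym (ℚₚ.∣-p∣≡∣p∣ (p ℚ.- q)))
  (cong ℚ.∣_∣ (solve 2 (λ p q → :- (p :+ :- q) := q :+ :- p) refl p q))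

p-q≤ε⇒p≤q+ε : ∀ {p q ε} → p ℚ.- q ℚ.≤ ε → p ℚ.≤ q ℚ.+ ε
p-q≤ε⇒p≤q+ε {p} {q} {ε} h = subst (ℚ._≤ q ℚ.+ ε)
  (solve 2 (λ p q → q :+ (p :+ :- q) := p) refl p q) (ℚₚ.+-monoʳ-≤ q h)

p≤q+ε⇒p-q≤ε : ∀ {p q ε} → p ℚ.≤ q ℚ.+ ε → p ℚ.- q ℚ.≤ ε
p≤q+ε⇒p-q≤ε {p} {q} {ε} h = subst (p ℚ.- q ℚ.≤_)
  (solve 2 (λ q e → (q :+ e) :+ :- q := e) refl q ε) (ℚₚ.+-monoˡ-≤ (ℚ.- q) h)

dist⇒≤ : ∀ p q {ε} → ℚ.∣ p ℚ.- q ∣ ℚ.≤ ε → p ℚ.≤ q ℚ.+ ε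
dist⇒≤ p q h = p-q≤ε⇒p≤q+ε (ℚₚ.≤-trans (p≤∣p∣ (p ℚ.- q)) h)

≤⇒dist : ∀ {p q ε} → p ℚ.≤ q ℚ.+ ε → q ℚ.≤ p ℚ.+ ε → ℚ.∣ p ℚ.- q ∣ ℚ.≤ ε
≤⇒dist {p} {q} {ε} h k with ℚₚ.∣p∣≡p∨∣p∣≡-p (p ℚ.- q)
... | inj₁ e = subst (ℚ._≤ ε) (sym e) (p≤q+ε⇒p-q≤ε h)
... | inj₂ e = subst (ℚ._≤ ε)
  (trans (solve 2 (λ p q → q :+ :- p := :- (p :+ :- q)) refl p q) (sym e))
  (p≤q+ε⇒p-q≤ε k)

p≤p+ε : ∀ {p ε} → 0ℚ ℚ.< ε → p ℚ.≤ p ℚ.+ ε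
p≤p+ε {p} {ε} h = subst (ℚ._≤ p ℚ.+ ε) (ℚₚ.+-identityʳ p)
  (ℚₚ.+-monoʳ-≤ p (ℚₚ.<⇒≤ h))

-- Equality of reals is _≈ʳ_, not _≡_.
record ℝ : Set where
  constructor mkℝ
  field
    seq    : ℕ → ℚ
    cauchy : ∀ ε → 0ℚ ℚ.< ε →
             ∃ λ N → ∀ m n → N ℕ.≤ m → N ℕ.≤ n → ℚ.∣ seq m ℚ.- seq n ∣ ℚ.≤ ε

open ℝ public

infix  4 _≤ʳ_ _<ʳ_ _≈ʳ_
infixl 6 _+ʳ_
infixl 7 _*ʳ_ _⊓ʳ_

_≤ʳ_ : Rel ℝ 0ℓ
x ≤ʳ y = ∀ ε → 0ℚ ℚ.< ε →
         ∃ λ N → ∀ n → N ℕ.≤ n → seq x n ℚ.≤ seq y n ℚ.+ ε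

_<ʳ_ : Rel ℝ 0ℓ
x <ʳ y = ∃ λ ε → 0ℚ ℚ.< ε ×
         ∃ λ N → ∀ n → N ℕ.≤ n → seq x n ℚ.+ ε ℚ.≤ seq y n

_≈ʳ_ : Rel ℝ 0ℓ
x ≈ʳ y = x ≤ʳ y × y ≤ʳ x

fromℚ : ℚ → ℝ
fromℚ q = mkℝ (λ _ → q) λ ε ε>0 → 0 , λ _ _ _ _ →
  subst (λ z → ℚ.∣ z ∣ ℚ.≤ ε) (sym (ℚₚ.+-inverseʳ q)) (ℚₚ.<⇒≤ ε>0)

0ʳ : ℝ
0ʳ = fromℚ 0ℚ

fromℕ : ℕ → ℝ
fromℕ n = fromℚ (+ n ℚ./ 1)

_+ʳ_ : ℝ → ℝ → ℝ
x +ʳ y = mkℝ (λ n → seq x n ℚ.+ seq y n) λ ε ε>0 →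
  let N₁ , h₁ = cauchy x (½ ℚ.* ε) (half>0 ε>0)
      N₂ , h₂ = cauchy y (½ ℚ.* ε) (half>0 ε>0)
  in N₁ ℕ.⊔ N₂ , λ m n N≤m N≤n →
    let a = seq x m; b = seq y m; a′ = seq x n; b′ = seq y n
        open ℚₚ.≤-Reasoning
    in begin
      ℚ.∣ (a ℚ.+ b) ℚ.- (a′ ℚ.+ b′) ∣
        ≡⟨ cong ℚ.∣_∣ (solve 4 (λ a b a′ b′ →
             (a :+ b) :+ :- (a′ :+ b′) := (a :+ :- a′) :+ (b :+ :- b′))
             refl a b a′ b′) ⟩
      ℚ.∣ (a ℚ.- a′) ℚ.+ (b ℚ.- b′) ∣
        ≤⟨ ℚₚ.∣p+q∣≤∣p∣+∣q∣ (a ℚ.- a′) (b ℚ.- b′) ⟩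
      ℚ.∣ a ℚ.- a′ ∣ ℚ.+ ℚ.∣ b ℚ.- b′ ∣
        ≤⟨ ℚₚ.+-mono-≤
             (h₁ m n (ℕₚ.m⊔n≤o⇒m≤o N₁ N₂ N≤m) (ℕₚ.m⊔n≤o⇒m≤o N₁ N₂ N≤n))
             (h₂ m n (ℕₚ.m⊔n≤o⇒n≤o N₁ N₂ N≤m) (ℕₚ.m⊔n≤o⇒n≤o N₁ N₂ N≤n)) ⟩
      ½ ℚ.* ε ℚ.+ ½ ℚ.* ε
        ≡⟨ halves ε ⟩
      ε ∎

bounded : ∀ x → ∃ λ K → 0ℚ ℚ.< K ×
          ∃ λ N → ∀ n → N ℕ.≤ n → ℚ.∣ seq x n ∣ ℚ.≤ K
bounded x =
  let N , h = cauchy x 1ℚ (ℚₚ.positive⁻¹ 1ℚ)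
      b     = seq x N
  in ℚ.∣ b ∣ ℚ.+ 1ℚ
   , ℚₚ.+-mono-≤-< (ℚₚ.0≤∣p∣ b) (ℚₚ.positive⁻¹ 1ℚ)
   , N
   , λ n N≤n → let a = seq x n; open ℚₚ.≤-Reasoning in begin
       ℚ.∣ a ∣
         ≡⟨ cong ℚ.∣_∣ (solve 2 (λ a b → a := b :+ (a :+ :- b)) refl a b) ⟩
       ℚ.∣ b ℚ.+ (a ℚ.- b) ∣
         ≤⟨ ℚₚ.∣p+q∣≤∣p∣+∣q∣ b (a ℚ.- b) ⟩
       ℚ.∣ b ∣ ℚ.+ ℚ.∣ a ℚ.- b ∣
         ≤⟨ ℚₚ.+-monoʳ-≤ ℚ.∣ b ∣ (h n N N≤n ℕₚ.≤-refl) ⟩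
       ℚ.∣ b ∣ ℚ.+ 1ℚ ∎

*-mono-∣∣ : ∀ p q {K δ} → 0ℚ ℚ.< K → ℚ.∣ p ∣ ℚ.≤ K → ℚ.∣ q ∣ ℚ.≤ δ →
            ℚ.∣ p ℚ.* q ∣ ℚ.≤ K ℚ.* δ
*-mono-∣∣ p q {K} {δ} K>0 hp hq = begin
  ℚ.∣ p ℚ.* q ∣         ≡⟨ ℚₚ.∣p*q∣≡∣p∣*∣q∣ p q ⟩
  ℚ.∣ p ∣ ℚ.* ℚ.∣ q ∣   ≤⟨ ℚₚ.*-monoʳ-≤-nonNeg ℚ.∣ q ∣ {{ℚₚ.∣-∣-nonNeg q}} hp ⟩
  K ℚ.* ℚ.∣ q ∣         ≤⟨ ℚₚ.*-monoˡ-≤-nonNeg K {{ℚ.nonNegative (ℚₚ.<⇒≤ K>0)}} hq ⟩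
  K ℚ.* δ               ∎
  where open ℚₚ.≤-Reasoning

divide : ∀ {K ε} → 0ℚ ℚ.< K → 0ℚ ℚ.< ε → ∃ λ δ → 0ℚ ℚ.< δ × K ℚ.* δ ≡ ε
divide {K} {ε} K>0 ε>0 = δ
  , ℚₚ.positive⁻¹ δ {{ℚₚ.pos*pos⇒pos (ℚ.1/ K) {{ℚₚ.1/pos⇒pos K}} ε}}
  , trans (sym (ℚₚ.*-assoc K (ℚ.1/ K) ε))
      (trans (cong (ℚ._* ε) (ℚₚ.*-inverseʳ K)) (ℚₚ.*-identityˡ ε))
  where
  instance
    K⁺ : ℚ.Positive K
    K⁺ = ℚ.positive K>0
    ε⁺ : ℚ.Positive ε
    ε⁺ = ℚ.positive ε>0
    K≢0 : ℚ.NonZero K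
    K≢0 = ℚₚ.pos⇒nonZero K
  δ = ℚ.1/ K ℚ.* ε

_*ʳ_ : ℝ → ℝ → ℝ
x *ʳ y = mkℝ (λ n → seq x n ℚ.* seq y n) λ ε ε>0 →
  let K , K>0 , M₁ , k = bounded x
      L , L>0 , M₂ , l = bounded y
      δ , δ>0 , Kδ = divide K>0 (half>0 ε>0)
      η , η>0 , Lη = divide L>0 (half>0 ε>0)
      N₁ , h₁ = cauchy x η η>0
      N₂ , h₂ = cauchy y δ δ>0
      M = M₁ ℕ.⊔ M₂
      N = N₁ ℕ.⊔ N₂
  in M ℕ.⊔ N , λ m n ≤m ≤n →
    let a = seq x m; b = seq y m; a′ = seq x n; b′ = seq y n
        M≤m = ℕₚ.m⊔n≤o⇒m≤o M N ≤m; N≤m = ℕₚ.m⊔n≤o⇒n≤o M N ≤m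
        M≤n = ℕₚ.m⊔n≤o⇒m≤o M N ≤n; N≤n = ℕₚ.m⊔n≤o⇒n≤o M N ≤n
        open ℚₚ.≤-Reasoning
    in begin
      ℚ.∣ a ℚ.* b ℚ.- a′ ℚ.* b′ ∣
        ≡⟨ cong ℚ.∣_∣ (solve 4 (λ a b a′ b′ →
             (a :* b) :+ :- (a′ :* b′) := a :* (b :+ :- b′) :+ b′ :* (a :+ :- a′))
             refl a b a′ b′) ⟩
      ℚ.∣ a ℚ.* (b ℚ.- b′) ℚ.+ b′ ℚ.* (a ℚ.- a′) ∣
        ≤⟨ ℚₚ.∣p+q∣≤∣p∣+∣q∣ (a ℚ.* (b ℚ.- b′)) (b′ ℚ.* (a ℚ.- a′)) ⟩
      ℚ.∣ a ℚ.* (b ℚ.- b′) ∣ ℚ.+ ℚ.∣ b′ ℚ.* (a ℚ.- a′) ∣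
        ≤⟨ ℚₚ.+-mono-≤
             (*-mono-∣∣ a (b ℚ.- b′) K>0 (k m (ℕₚ.m⊔n≤o⇒m≤o M₁ M₂ M≤m))
               (h₂ m n (ℕₚ.m⊔n≤o⇒n≤o N₁ N₂ N≤m) (ℕₚ.m⊔n≤o⇒n≤o N₁ N₂ N≤n)))
             (*-mono-∣∣ b′ (a ℚ.- a′) L>0 (l n (ℕₚ.m⊔n≤o⇒n≤o M₁ M₂ M≤n))
               (h₁ m n (ℕₚ.m⊔n≤o⇒m≤o N₁ N₂ N≤m) (ℕₚ.m⊔n≤o⇒m≤o N₁ N₂ N≤n))) ⟩
      K ℚ.* δ ℚ.+ L ℚ.* η
        ≡⟨ cong₂ ℚ._+_ Kδ Lη ⟩
      ½ ℚ.* ε ℚ.+ ½ ℚ.* ε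
        ≡⟨ halves ε ⟩
      ε ∎

sumʳ : ∀ {n} → (Fin n → ℝ) → ℝ
sumʳ = Vector.foldr _+ʳ_ 0ʳ

ℝ⁺ : Set
ℝ⁺ = Σ ℝ (0ʳ <ʳ_)

-- Over ℝ attainment of a minimum is not constructively available even for two
-- numbers, so it is stated classically, with a double negation.
IsMinimum : (ℝ → Set) → ℝ → Set
IsMinimum P m = ¬ ¬ P m × (∀ x → P x → m ≤ʳ x)

record SimpleGraph : Set₁ where
  field
    order  : ℕ
    _~_    : Rel (Fin order) 0ℓ
    _~?_   : Decidable _~_
    ~-sym  : Symmetric _~_
    ~-irrefl : ∀ {u} → ¬ (u ~ u)

  V : Set
  V = Fin order

  neighborsIn : V → List V → List V
  neighborsIn u = filter (u ~?_)

  deg : V → ℕ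
  deg u = length (neighborsIn u (allFin order))

open SimpleGraph public using (V; deg)

module _ (G : SimpleGraph) where
  open SimpleGraph G hiding (V; deg)

  IsLinearOrderingOf : Subset order → List (V G) → Set
  IsLinearOrderingOf I us = Unique us × (∀ v → v ∈ us ⇔ v ∈ₛ I)

  -- take (toℕ i) us lists the vertices strictly before position i.
  BackDegreesBoundedBy : (V G → ℤ) → List (V G) → Set
  BackDegreesBoundedBy lam us = ∀ (i : Fin (length us)) →
    + length (neighborsIn (lookup us i) (take (toℕ i) us)) ℤ.≤ lam (lookup us i)

  IsDegenerate : (V G → ℤ) → Subset order → Set
  IsDegenerate lam I = ∃ λ us → IsLinearOrderingOf I us × BackDegreesBoundedBy lam us

cost : ∀ G → (V G → ℝ⁺) → (V G → ℕ) → ℝ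
cost G c ι = sumʳ λ u → proj₁ (c u) *ʳ fromℕ (ι u)

IsFeasibleCost : ∀ G → (V G → ℝ⁺) → (V G → ℤ) → ℝ → Set
IsFeasibleCost G c κ x = ∃ λ (ι : V G → ℕ) →
  IsDegenerate G (λ u → κ u ℤ.+ + ι u) ⊤ × x ≈ʳ cost G c ι

≤ʳ-refl : ∀ {x} → x ≤ʳ x
≤ʳ-refl ε ε>0 = 0 , λ _ _ → p≤p+ε ε>0

≤ʳ-trans : ∀ {x y z} → x ≤ʳ y → y ≤ʳ z → x ≤ʳ z
≤ʳ-trans {x} {y} {z} p q ε ε>0 =
  let N₁ , h₁ = p (½ ℚ.* ε) (half>0 ε>0)
      N₂ , h₂ = q (½ ℚ.* ε) (half>0 ε>0)
  in N₁ ℕ.⊔ N₂ , λ n N≤n → let open ℚₚ.≤-Reasoning in begin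
    seq x n
      ≤⟨ h₁ n (ℕₚ.m⊔n≤o⇒m≤o N₁ N₂ N≤n) ⟩
    seq y n ℚ.+ ½ ℚ.* ε
      ≤⟨ ℚₚ.+-monoˡ-≤ (½ ℚ.* ε) (h₂ n (ℕₚ.m⊔n≤o⇒n≤o N₁ N₂ N≤n)) ⟩
    seq z n ℚ.+ ½ ℚ.* ε ℚ.+ ½ ℚ.* ε
      ≡⟨ ℚₚ.+-assoc (seq z n) (½ ℚ.* ε) (½ ℚ.* ε) ⟩
    seq z n ℚ.+ (½ ℚ.* ε ℚ.+ ½ ℚ.* ε)
      ≡⟨ cong (seq z n ℚ.+_) (halves ε) ⟩
    seq z n ℚ.+ ε ∎

+ʳ-mono-≤ : ∀ {x x′ y y′} → x ≤ʳ x′ → y ≤ʳ y′ → x +ʳ y ≤ʳ x′ +ʳ y′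
+ʳ-mono-≤ {x} {x′} {y} {y′} p q ε ε>0 =
  let N₁ , h₁ = p (½ ℚ.* ε) (half>0 ε>0)
      N₂ , h₂ = q (½ ℚ.* ε) (half>0 ε>0)
  in N₁ ℕ.⊔ N₂ , λ n N≤n → let open ℚₚ.≤-Reasoning in begin
    seq x n ℚ.+ seq y n
      ≤⟨ ℚₚ.+-mono-≤ (h₁ n (ℕₚ.m⊔n≤o⇒m≤o N₁ N₂ N≤n)) (h₂ n (ℕₚ.m⊔n≤o⇒n≤o N₁ N₂ N≤n)) ⟩
    (seq x′ n ℚ.+ ½ ℚ.* ε) ℚ.+ (seq y′ n ℚ.+ ½ ℚ.* ε)
      ≡⟨ solve 3 (λ a b e → (a :+ e) :+ (b :+ e) := (a :+ b) :+ (e :+ e))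
           refl (seq x′ n) (seq y′ n) (½ ℚ.* ε) ⟩
    (seq x′ n ℚ.+ seq y′ n) ℚ.+ (½ ℚ.* ε ℚ.+ ½ ℚ.* ε)
      ≡⟨ cong ((seq x′ n ℚ.+ seq y′ n) ℚ.+_) (halves ε) ⟩
    (seq x′ n ℚ.+ seq y′ n) ℚ.+ ε ∎

sumʳ-mono-≤ : ∀ {n} {f g : Fin n → ℝ} → (∀ i → f i ≤ʳ g i) → sumʳ f ≤ʳ sumʳ g
sumʳ-mono-≤ {zero}          h = ≤ʳ-refl {0ʳ}
sumʳ-mono-≤ {suc n} {f} {g} h =
  +ʳ-mono-≤ {f zero} {g zero} {sumʳ (f ∘ suc)} {sumʳ (g ∘ suc)}
    (h zero) (sumʳ-mono-≤ {n} {f ∘ suc} {g ∘ suc} (h ∘ suc))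

*ʳ-monoˡ-≤ : ∀ (c : ℝ⁺) {p q} → p ℚ.≤ q → proj₁ c *ʳ fromℚ p ≤ʳ proj₁ c *ʳ fromℚ q
*ʳ-monoˡ-≤ (c , δ , δ>0 , N , h) {p} {q} p≤q ε ε>0 = N , λ n N≤n →
  ℚₚ.≤-trans
    (ℚₚ.*-monoˡ-≤-nonNeg (seq c n) {{ℚ.nonNegative
      (ℚₚ.≤-trans (ℚₚ.<⇒≤ δ>0) (subst (ℚ._≤ seq c n) (ℚₚ.+-identityˡ δ) (h n N≤n)))}} p≤q)
    (p≤p+ε ε>0)

/1-mono-≤ : ∀ {m n} → m ℕ.≤ n → + m ℚ./ 1 ℚ.≤ + n ℚ./ 1
/1-mono-≤ {m} {n} m≤n = ℚₚ.toℚᵘ-cancel-≤ (begin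
  ℚ.toℚᵘ (+ m ℚ./ 1)  ≃⟨ ℚₚ.toℚᵘ-fromℚᵘ (ℚᵘ.mkℚᵘ (+ m) 0) ⟩
  ℚᵘ.mkℚᵘ (+ m) 0     ≤⟨ ℚᵘ.*≤* (ℤₚ.*-monoʳ-≤-nonNeg (+ 1) (ℤ.+≤+ m≤n)) ⟩
  ℚᵘ.mkℚᵘ (+ n) 0     ≃⟨ ℚₚ.toℚᵘ-fromℚᵘ (ℚᵘ.mkℚᵘ (+ n) 0) ⟨
  ℚ.toℚᵘ (+ n ℚ./ 1)  ∎)
  where open ℚᵘₚ.≤-Reasoning

cost-mono-≤ : ∀ G (c : V G → ℝ⁺) {ι ι′ : V G → ℕ} → (∀ u → ι u ℕ.≤ ι′ u) →
              cost G c ι ≤ʳ cost G c ι′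
cost-mono-≤ G c {ι} {ι′} h = sumʳ-mono-≤
  {f = λ u → proj₁ (c u) *ʳ fromℕ (ι u)} {λ u → proj₁ (c u) *ʳ fromℕ (ι′ u)}
  (λ u → *ʳ-monoˡ-≤ (c u) (/1-mono-≤ (h u)))

_⊓ʳ_ : ℝ → ℝ → ℝ
x ⊓ʳ y = mkℝ (λ n → seq x n ℚ.⊓ seq y n) λ ε ε>0 →
  let N₁ , h₁ = cauchy x ε ε>0
      N₂ , h₂ = cauchy y ε ε>0
      close : ∀ m n → N₁ ℕ.⊔ N₂ ℕ.≤ m → N₁ ℕ.⊔ N₂ ℕ.≤ n →
              seq x m ℚ.⊓ seq y m ℚ.≤ (seq x n ℚ.⊓ seq y n) ℚ.+ ε
      close m n N≤m N≤n = subst (seq x m ℚ.⊓ seq y m ℚ.≤_)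
        (sym (ℚₚ.mono-≤-distrib-⊓ (ℚₚ.+-monoˡ-≤ ε) (seq x n) (seq y n)))
        (ℚₚ.⊓-mono-≤ {seq x m} {seq x n ℚ.+ ε} {seq y m} {seq y n ℚ.+ ε}
          (dist⇒≤ (seq x m) (seq x n) (h₁ m n (ℕₚ.m⊔n≤o⇒m≤o N₁ N₂ N≤m) (ℕₚ.m⊔n≤o⇒m≤o N₁ N₂ N≤n)))
          (dist⇒≤ (seq y m) (seq y n) (h₂ m n (ℕₚ.m⊔n≤o⇒n≤o N₁ N₂ N≤m) (ℕₚ.m⊔n≤o⇒n≤o N₁ N₂ N≤n))))
  in N₁ ℕ.⊔ N₂ , λ m n N≤m N≤n → ≤⇒dist (close m n N≤m N≤n) (close n m N≤n N≤m)

x⊓y≤ʳx : ∀ x y → x ⊓ʳ y ≤ʳ x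
x⊓y≤ʳx x y ε ε>0 = 0 , λ n _ →
  ℚₚ.≤-trans (ℚₚ.p⊓q≤p (seq x n) (seq y n)) (p≤p+ε ε>0)

x⊓y≤ʳy : ∀ x y → x ⊓ʳ y ≤ʳ y
x⊓y≤ʳy x y ε ε>0 = 0 , λ n _ →
  ℚₚ.≤-trans (ℚₚ.p⊓q≤q (seq x n) (seq y n)) (p≤p+ε ε>0)

⊓ʳ-glb : ∀ {x y z} → z ≤ʳ x → z ≤ʳ y → z ≤ʳ x ⊓ʳ y
⊓ʳ-glb {x} {y} {z} p q ε ε>0 =
  let N₁ , h₁ = p ε ε>0
      N₂ , h₂ = q ε ε>0
  in N₁ ℕ.⊔ N₂ , λ n N≤n → subst (seq z n ℚ.≤_)
    (sym (ℚₚ.mono-≤-distrib-⊓ (ℚₚ.+-monoˡ-≤ ε) (seq x n) (seq y n)))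
    (ℚₚ.⊓-glb (h₁ n (ℕₚ.m⊔n≤o⇒m≤o N₁ N₂ N≤n)) (h₂ n (ℕₚ.m⊔n≤o⇒n≤o N₁ N₂ N≤n)))

≰ʳ⇒≥ʳ : ∀ {x y} → ¬ (x ≤ʳ y) → y ≤ʳ x
≰ʳ⇒≥ʳ {x} {y} x≰y ε ε>0 = N , go
  where
  δ    = ½ ℚ.* (½ ℚ.* ε)
  δ>0  = half>0 (half>0 ε>0)
  N₁   = proj₁ (cauchy x δ δ>0)
  h₁   = proj₂ (cauchy x δ δ>0)
  N₂   = proj₁ (cauchy y δ δ>0)
  h₂   = proj₂ (cauchy y δ δ>0)
  N    = N₁ ℕ.⊔ N₂
  N₁≤N = ℕₚ.m≤m⊔n N₁ N₂
  N₂≤N = ℕₚ.m≤n⊔m N₁ N₂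
  X    = seq x N
  Y    = seq y N

  δδδδ : δ ℚ.+ δ ℚ.+ (δ ℚ.+ δ) ≡ ε
  δδδδ = trans (cong₂ ℚ._+_ (halves (½ ℚ.* ε)) (halves (½ ℚ.* ε))) (halves ε)

  open ℚₚ.≤-Reasoning

  far : X ℚ.+ (δ ℚ.+ δ) ℚ.≤ Y → x ≤ʳ y
  far gap η η>0 = N , λ n N≤n →
    let N₁≤n = ℕₚ.≤-trans N₁≤N N≤n
        N₂≤n = ℕₚ.≤-trans N₂≤N N≤n
    in ℚₚ.≤-trans (begin
      seq x n
        ≤⟨ dist⇒≤ (seq x n) X (h₁ n N N₁≤n N₁≤N) ⟩
      X ℚ.+ δ
        ≡⟨ solve 2 (λ a d → a :+ d := (a :+ (d :+ d)) :+ :- d) refl X δ ⟩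
      X ℚ.+ (δ ℚ.+ δ) ℚ.- δ
        ≤⟨ ℚₚ.+-monoˡ-≤ (ℚ.- δ) gap ⟩
      Y ℚ.- δ
        ≤⟨ ℚₚ.+-monoˡ-≤ (ℚ.- δ) {Y} {seq y n ℚ.+ δ} (dist⇒≤ Y (seq y n) (h₂ N n N₂≤N N₂≤n)) ⟩
      seq y n ℚ.+ δ ℚ.- δ
        ≡⟨ solve 2 (λ a d → (a :+ d) :+ :- d := a) refl (seq y n) δ ⟩
      seq y n ∎) (p≤p+ε η>0)

  go : ∀ n → N ℕ.≤ n → seq y n ℚ.≤ seq x n ℚ.+ ε
  go n N≤n with ℚₚ.≤-total (X ℚ.+ (δ ℚ.+ δ)) Y
  ... | inj₁ gap = contradiction (far gap) x≰y
  ... | inj₂ Y≤  = begin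
      seq y n
        ≤⟨ dist⇒≤ (seq y n) Y (h₂ n N (ℕₚ.≤-trans N₂≤N N≤n) N₂≤N) ⟩
      Y ℚ.+ δ
        ≤⟨ ℚₚ.+-monoˡ-≤ δ Y≤ ⟩
      X ℚ.+ (δ ℚ.+ δ) ℚ.+ δ
        ≤⟨ ℚₚ.+-monoˡ-≤ δ (ℚₚ.+-monoˡ-≤ (δ ℚ.+ δ) {X} {seq x n ℚ.+ δ}
             (dist⇒≤ X (seq x n) (h₁ N n N₁≤N (ℕₚ.≤-trans N₁≤N N≤n)))) ⟩
      seq x n ℚ.+ δ ℚ.+ (δ ℚ.+ δ) ℚ.+ δ
        ≡⟨ solve 2 (λ a d → ((a :+ d) :+ (d :+ d)) :+ d := a :+ ((d :+ d) :+ (d :+ d)))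
             refl (seq x n) δ ⟩
      seq x n ℚ.+ (δ ℚ.+ δ ℚ.+ (δ ℚ.+ δ))
        ≡⟨ cong (seq x n ℚ.+_) δδδδ ⟩
      seq x n ℚ.+ ε ∎

module _ {A : Set} (f : A → ℝ) where

  minOver : A → List A → ℝ
  minOver a []       = f a
  minOver a (b ∷ bs) = f b ⊓ʳ minOver a bs

  minOver-≤ : ∀ a bs {x} → x ∈ (a ∷ bs) → minOver a bs ≤ʳ f x
  minOver-≤ a []       (here refl)         = ≤ʳ-refl {f a}
  minOver-≤ a (b ∷ bs) {x} x∈ = case x∈ of λ where
      (here x≡a)           → rest (here x≡a)
      (there (here refl))  → x⊓y≤ʳx (f b) (minOver a bs)
      (there (there x∈bs)) → rest (there x∈bs)
    where
    rest : x ∈ (a ∷ bs) → minOver a (b ∷ bs) ≤ʳ f x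
    rest x∈ = ≤ʳ-trans {f b ⊓ʳ minOver a bs} {minOver a bs} {f x}
      (x⊓y≤ʳy (f b) (minOver a bs)) (minOver-≤ a bs x∈)

  weaken : ∀ {a b x} {bs : List A} → x ∈ (a ∷ bs) → x ∈ (a ∷ b ∷ bs)
  weaken (here p)  = here p
  weaken (there p) = there (there p)

  minOver-attained : ∀ a bs → ¬ ¬ (∃ λ x → x ∈ (a ∷ bs) × minOver a bs ≈ʳ f x)
  minOver-attained a [] k = k (a , here refl , ≤ʳ-refl {f a} , ≤ʳ-refl {f a})
  minOver-attained a (b ∷ bs) k = minOver-attained a bs λ where
    (x , x∈ , m≤fx , fx≤m) →
      let m = minOver a bs
          b≰m : ¬ (f b ≤ʳ m)
          b≰m b≤m = k (b , there (here refl) , x⊓y≤ʳx (f b) m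
                      , ⊓ʳ-glb {f b} {m} {f b} (≤ʳ-refl {f b}) b≤m)
          m≤b = ≰ʳ⇒≥ʳ {f b} {m} b≰m
      in k (x , weaken x∈
           , ≤ʳ-trans {f b ⊓ʳ m} {m} {f x} (x⊓y≤ʳy (f b) m) m≤fx
           , ≤ʳ-trans {f x} {m} {f b ⊓ʳ m} fx≤m
               (⊓ʳ-glb {f b} {m} {m} m≤b (≤ʳ-refl {m})))

vecs : ∀ {A : Set} {n} → (Fin n → List A) → List (Vec A n)
vecs {n = zero}  xs = [] ∷ []
vecs {n = suc n} xs = cartesianProductWith _∷_ (xs zero) (vecs (xs ∘ suc))

∈-vecs : ∀ {A : Set} {n} (xs : Fin n → List A) (f : Fin n → A) →
         (∀ i → f i ∈ xs i) → Vec.tabulate f ∈ vecs xs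
∈-vecs {n = zero}  xs f h = here refl
∈-vecs {n = suc n} xs f h =
  ∈-cartesianProductWith⁺ _∷_ (h zero) (∈-vecs (xs ∘ suc) (f ∘ suc) (h ∘ suc))

listsUpTo : ∀ {A : Set} → List A → ℕ → List (List A)
listsUpTo xs zero    = [] ∷ []
listsUpTo xs (suc k) = [] ∷ cartesianProductWith _∷_ xs (listsUpTo xs k)

∈-listsUpTo : ∀ {A : Set} (xs : List A) → (∀ x → x ∈ xs) →
              ∀ k l → length l ℕ.≤ k → l ∈ listsUpTo xs k
∈-listsUpTo xs h zero    []      _           = here refl
∈-listsUpTo xs h (suc k) []      _           = here refl
∈-listsUpTo xs h (suc k) (x ∷ l) (ℕ.s≤s ≤k) =
  there (∈-cartesianProductWith⁺ _∷_ (h x) (∈-listsUpTo xs h k l ≤k))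

Unique⇒lookup-injective : ∀ {A : Set} {xs : List A} → Unique xs →
  ∀ {i j} → lookup xs i ≡ lookup xs j → i ≡ j
Unique⇒lookup-injective (_ AllPairs.∷ _)  {zero}  {zero}  _  = refl
Unique⇒lookup-injective (p AllPairs.∷ _)  {zero}  {suc j} eq =
  contradiction eq (All.lookup p (∈-lookup j))
Unique⇒lookup-injective (p AllPairs.∷ _)  {suc i} {zero}  eq =
  contradiction (sym eq) (All.lookup p (∈-lookup i))
Unique⇒lookup-injective (_ AllPairs.∷ ps) {suc i} {suc j} eq =
  cong suc (Unique⇒lookup-injective ps eq)

Unique⇒length≤ : ∀ {n} {us : List (Fin n)} → Unique us → length us ℕ.≤ n
Unique⇒length≤ p = Finₚ.injective⇒≤ (Unique⇒lookup-injective p)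

n≤i+n+∣i∣ : ∀ n i → + n ℤ.≤ i ℤ.+ + (n ℕ.+ ℤ.∣ i ∣)
n≤i+n+∣i∣ n (+ k)      = ℤ.+≤+ (ℕₚ.≤-trans (ℕₚ.m≤m+n n k) (ℕₚ.m≤n+m (n ℕ.+ k) k))
n≤i+n+∣i∣ n (-[1+ k ]) = ℤₚ.≤-reflexive (begin
  + n                           ≡⟨ cong +_ (ℕₚ.m+n∸n≡m n (suc k)) ⟨
  + (n ℕ.+ suc k ℕ.∸ suc k)     ≡⟨ ℤₚ.⊖-≥ (ℕₚ.m≤n+m (suc k) n) ⟨
  (n ℕ.+ suc k) ℤ.⊖ suc k       ∎)
  where open ≡-Reasoning

module Minimum (G : SimpleGraph) (c : V G → ℝ⁺) (κ : V G → ℤ) where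
  open SimpleGraph G hiding (V; deg)
  open DecMembership (Finₚ._≟_ {order}) using (_∈?_)
  open DecUnique (Finₚ._≟_ {order}) using (unique?)

  shift : (V G → ℕ) → V G → ℤ
  shift ι u = κ u ℤ.+ + ι u

  Witness : Vec ℕ order × List (V G) → Set
  Witness (v , us) = IsLinearOrderingOf G ⊤ us
                   × BackDegreesBoundedBy G (shift (Vec.lookup v)) us

  witness? : ∀ p → Dec (Witness p)
  witness? (v , us) =
    (unique? us ×-dec Finₚ.all? λ w → map′
      (λ w∈ → mk⇔ (λ _ → ∈⊤) (λ _ → w∈)) (λ e → Equivalence.from e ∈⊤) (w ∈? us))
    ×-dec Finₚ.all? (λ i → _ ℤₚ.≤? _)

  -- An increment above this bound never helps.
  cap : V G → ℕ
  cap u = order ℕ.+ ℤ.∣ κ u ∣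

  candidates : List (Vec ℕ order × List (V G))
  candidates = cartesianProduct
    (vecs λ u → upTo (suc (cap u))) (listsUpTo (allFin order) order)

  capped : List (Vec ℕ order × List (V G))
  capped = filter witness? candidates

  value : Vec ℕ order × List (V G) → ℝ
  value (v , _) = cost G c (Vec.lookup v)

  backDegree≤order : ∀ {us} → Unique us → ∀ i →
    length (neighborsIn (lookup us i) (take (toℕ i) us)) ℕ.≤ order
  backDegree≤order {us} p i = begin
    length (neighborsIn (lookup us i) (take (toℕ i) us))
      ≤⟨ Listₚ.length-filter (lookup us i ~?_) (take (toℕ i) us) ⟩
    length (take (toℕ i) us)    ≡⟨ Listₚ.length-take (toℕ i) us ⟩
    toℕ i ℕ.⊓ length us         ≤⟨ ℕₚ.m⊓n≤n (toℕ i) (length us) ⟩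
    length us                   ≤⟨ Unique⇒length≤ p ⟩
    order                       ∎
    where open ℕₚ.≤-Reasoning

  truncate : (V G → ℕ) → V G → ℕ
  truncate ι u = ι u ℕ.⊓ cap u

  truncate-witness : ∀ ι us → IsLinearOrderingOf G ⊤ us →
    BackDegreesBoundedBy G (shift ι) us → Witness (Vec.tabulate (truncate ι) , us)
  truncate-witness ι us ord@(uniq , _) h = ord , λ i →
    let u = lookup us i
        k = length (neighborsIn u (take (toℕ i) us))
    in subst (λ t → + k ℤ.≤ κ u ℤ.+ + t) (sym (Vecₚ.lookup∘tabulate (truncate ι) u))
       (case ℕₚ.⊓-sel (ι u) (cap u) of λ where
         (inj₁ e) → subst (λ t → + k ℤ.≤ κ u ℤ.+ + t) (sym e) (h i)
         (inj₂ e) → subst (λ t → + k ℤ.≤ κ u ℤ.+ + t) (sym e)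
           (ℤₚ.≤-trans (ℤ.+≤+ (backDegree≤order uniq i)) (n≤i+n+∣i∣ order (κ u))))

  truncate-∈ : ∀ ι us → IsLinearOrderingOf G ⊤ us →
    BackDegreesBoundedBy G (shift ι) us → (Vec.tabulate (truncate ι) , us) ∈ capped
  truncate-∈ ι us ord h = ∈-filter⁺ witness?
    (∈-cartesianProduct⁺
      (∈-vecs (λ u → upTo (suc (cap u))) (truncate ι)
        (λ u → ∈-upTo⁺ (ℕ.s≤s (ℕₚ.m⊓n≤n (ι u) (cap u)))))
      (∈-listsUpTo (allFin order) ∈-allFin order us (Unique⇒length≤ (proj₁ ord))))
    (truncate-witness ι us ord h)

  start : Vec ℕ order × List (V G)
  start = Vec.tabulate (truncate cap) , allFin order

  start-witness : Witness start
  start-witness = truncate-witness cap (allFin order)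
    (uniq , λ w → mk⇔ (λ _ → ∈⊤) (λ _ → ∈-allFin w))
    (λ i → ℤₚ.≤-trans (ℤ.+≤+ (backDegree≤order uniq i))
                      (n≤i+n+∣i∣ order (κ (lookup (allFin order) i))))
    where uniq = Uniqueₚ.allFin⁺ order

  minimum : Σ ℝ (IsMinimum (IsFeasibleCost G c κ))
  minimum = m , attained , lower
    where
    m = minOver value start capped

    witness : ∀ {p} → p ∈ (start ∷ capped) → Witness p
    witness (here refl) = start-witness
    witness (there p∈)  = proj₂ (∈-filter⁻ witness? {xs = candidates} p∈)

    attained : ¬ ¬ IsFeasibleCost G c κ m
    attained k = minOver-attained value start capped λ where
      ((v , us) , p∈ , m≈) → k (Vec.lookup v , (us , witness p∈) , m≈)

    lower : ∀ x → IsFeasibleCost G c κ x → m ≤ʳ x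
    lower x (ι , (us , ord , h) , _ , cost≤x) =
      let p = Vec.tabulate (truncate ι) , us
      in ≤ʳ-trans {m} {value p} {x} (minOver-≤ value start capped (there (truncate-∈ ι us ord h)))
         (≤ʳ-trans {value p} {cost G c ι} {x}
           (cost-mono-≤ G c {Vec.lookup (Vec.tabulate (truncate ι))} {ι} λ u →
             subst (ℕ._≤ ι u) (sym (Vecₚ.lookup∘tabulate (truncate ι) u))
               (ℕₚ.m⊓n≤m (ι u) (cap u)))
           cost≤x)

-- β is opaque: it is to be used through β-isMinimum, which determines it
-- up to _≈ʳ_.
opaque
  β : ∀ G → (V G → ℝ⁺) → (V G → ℤ) → ℝ
  β G c κ = proj₁ (Minimum.minimum G c κ)

  β-isMinimum : ∀ G c κ → IsMinimum (IsFeasibleCost G c κ) (β G c κ)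
  β-isMinimum G c κ = proj₂ (Minimum.minimum G c κ)

{-# OPTIONS --safe #-}

-- First let the costs w be rational.  Put f(k,d) = (d-k)(d-k+1)/(2(d+1)) for
-- k ≤ d and 0 otherwise; it satisfies
--   max(d-k,0) = f(k,d) + d (f(k,d) - f(k,d-1)).
-- Order a vertex set S by placing last the vertex v that minimises
-- g(u) = w(u) (f(κ(u),d_S(u)) - f(κ(u),d_S(u)-1)).  It costs
-- w(v) max(d_S(v)-κ(v),0) = w(v) f(κ(v),d_S(v)) + d_S(v) g(v), and its removal
-- lowers the bound on S ∖ v by the sum of g over the neighbours of v in S,
-- which is at least d_S(v) g(v).
-- Minimisers are not computable over the reals, so for real costs w consists of
-- the rational approximants at a large index; one index serves all orderings,
-- since there are finitely many of them.
module Submission where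

open import Defs
open import Data.Fin.Base using (Fin; zero; suc; toℕ)
import Data.Fin.Properties as Finₚ
open import Data.Fin.Subset using (⊤)
open import Data.Fin.Subset.Properties using (∈⊤)
open import Data.Integer.Base as ℤ using (ℤ; +_; 0ℤ; 1ℤ; _≤_; _+_; _-_; _*_)
import Data.Integer.Properties as ℤₚ
open import Data.Integer.Tactic.RingSolver using (solve-∀)
open import Data.List.Base using (List; []; _∷_; [_]; _++_; length; filter; take; takeWhile; lookup; allFin; tabulate)
open import Data.List.Membership.Propositional using (_∈_; _∉_)
open import Data.List.Membership.Propositional.Properties using (∈-filter⁺; ∈-filter⁻; ∈-allFin; ∈-lookup)
import Data.List.Membership.DecPropositional as DecMembership
import Data.List.Properties as Listₚ
open import Data.List.Relation.Binary.Permutation.Propositional using (_↭_; refl; prep; swap; trans; ↭-sym; ↭-refl; ↭⇒↭ₛ)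
open import Data.List.Relation.Binary.Permutation.Propositional.Properties using (∈-resp-↭; ↭-length; filter-↭; ++-comm)
import Data.List.Relation.Binary.Permutation.Setoid.Properties as Permₛ
open import Data.List.Relation.Unary.All as All using (All)
open import Data.List.Relation.Unary.AllPairs as AllPairs using (_∷_)
open import Data.List.Relation.Unary.Any using (here; there)
open import Data.List.Relation.Unary.Unique.Propositional using (Unique)
import Data.List.Relation.Unary.Unique.Propositional.Properties as Uniqueₚ
import Data.List.Relation.Unary.Unique.DecPropositional as DecUnique
open import Data.Nat.Base as ℕ using (ℕ; zero; suc; _∸_)
import Data.Nat.Properties as ℕₚ
import Data.Nat.Tactic.RingSolver as ℕSolver
open import Data.Product.Base using (∃; ∃₂; _×_; _,_; proj₁; proj₂)
open import Data.Rational.Base as ℚ using (ℚ; 0ℚ; 1ℚ; ½; _/_)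
import Data.Rational.Properties as ℚₚ
open import Data.Rational.Solver using (module +-*-Solver)
import Data.Rational.Unnormalised.Base as ℚᵘ
import Data.Rational.Unnormalised.Properties as ℚᵘₚ
open import Data.Sum.Base using (inj₁; inj₂)
open import Function.Base using (_∘_)
open import Function.Bundles using (mk⇔; Equivalence)
open import Relation.Binary.PropositionalEquality as ≡ using (_≡_; _≢_; cong; cong₂; subst; setoid)
open import Relation.Nullary using (¬_; Dec; yes; no; ¬?; contradiction)
open import Relation.Nullary.Decidable using (_×-dec_; map′)

open +-*-Solver using (solve; _:+_; _:*_; :-_; _:=_; con)

-- Rational arithmetic of the mean excess.

ratio : ℕ → ℚ
ratio n = + n / 1

ratio-+ : ∀ m n → ratio (m ℕ.+ n) ≡ ratio m ℚ.+ ratio n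
ratio-+ m n = ℚₚ.toℚᵘ-injective (begin
  ℚ.toℚᵘ (ratio (m ℕ.+ n))
    ≈⟨ ℚₚ.toℚᵘ-fromℚᵘ (ℚᵘ.mkℚᵘ (+ (m ℕ.+ n)) 0) ⟩
  ℚᵘ.mkℚᵘ (+ (m ℕ.+ n)) 0
    ≈⟨ ℚᵘ.*≡* (≡.cong (ℤ._* 1ℤ) (≡.cong₂ ℤ._+_ (≡.sym (ℤₚ.*-identityʳ (+ m))) (≡.sym (ℤₚ.*-identityʳ (+ n))))) ⟩
  ℚᵘ.mkℚᵘ (+ m) 0 ℚᵘ.+ ℚᵘ.mkℚᵘ (+ n) 0
    ≈⟨ ℚᵘₚ.+-cong (ℚₚ.toℚᵘ-fromℚᵘ (ℚᵘ.mkℚᵘ (+ m) 0)) (ℚₚ.toℚᵘ-fromℚᵘ (ℚᵘ.mkℚᵘ (+ n) 0)) ⟨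
  ℚ.toℚᵘ (ratio m) ℚᵘ.+ ℚ.toℚᵘ (ratio n)
    ≈⟨ ℚₚ.toℚᵘ-homo-+ (ratio m) (ratio n) ⟨
  ℚ.toℚᵘ (ratio m ℚ.+ ratio n) ∎)
  where open ℚᵘₚ.≃-Reasoning

-- Clears the denominator of `meanExcess`, so that its values at `d` and `suc d` can be compared
-- without division.
*-half-fraction : ∀ t d → ratio (suc d) ℚ.* (+ t / (2 ℕ.* suc d)) ≡ ½ ℚ.* ratio t
*-half-fraction t d = ℚₚ.toℚᵘ-injective (begin
  ℚ.toℚᵘ (ratio (suc d) ℚ.* (+ t / (2 ℕ.* suc d)))
    ≈⟨ ℚₚ.toℚᵘ-homo-* (ratio (suc d)) (+ t / (2 ℕ.* suc d)) ⟩
  ℚ.toℚᵘ (ratio (suc d)) ℚᵘ.* ℚ.toℚᵘ (+ t / (2 ℕ.* suc d))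
    ≈⟨ ℚᵘₚ.*-cong (ℚₚ.toℚᵘ-fromℚᵘ (ℚᵘ.mkℚᵘ (+ suc d) 0)) (ℚₚ.toℚᵘ-fromℚᵘ (+ t ℚᵘ./ (2 ℕ.* suc d))) ⟩
  ℚᵘ.mkℚᵘ (+ suc d) 0 ℚᵘ.* (+ t ℚᵘ./ (2 ℕ.* suc d))
    ≈⟨ ℚᵘ.*≡* (cross (+ suc d) (+ t)) ⟩
  ℚᵘ.½ ℚᵘ.* ℚᵘ.mkℚᵘ (+ t) 0
    ≈⟨ ℚᵘₚ.*-cong (ℚᵘₚ.≃-refl {ℚᵘ.½}) (ℚₚ.toℚᵘ-fromℚᵘ (ℚᵘ.mkℚᵘ (+ t) 0)) ⟨
  ℚ.toℚᵘ ½ ℚᵘ.* ℚ.toℚᵘ (ratio t)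
    ≈⟨ ℚₚ.toℚᵘ-homo-* ½ (ratio t) ⟨
  ℚ.toℚᵘ (½ ℚ.* ratio t) ∎)
  where
  open ℚᵘₚ.≃-Reasoning
  cross : ∀ s t → (s ℤ.* t) ℤ.* + 2 ≡ (1ℤ ℤ.* t) ℤ.* (1ℤ ℤ.* (+ 2 ℤ.* s))
  cross = solve-∀

-- The expectation of b ∸ k for b uniform in {0,…,d}.
meanExcess : ℕ → ℕ → ℚ
meanExcess k d = + ((d ∸ k) ℕ.* suc (d ∸ k)) / (2 ℕ.* suc d)

-- The amount by which `meanExcess k` changes when a vertex of degree `d` loses one neighbour. The
-- value at `zero` is a default; in `excess-split` it is multiplied by `ratio zero`.
increment : ℕ → ℕ → ℚ
increment k zero    = 0ℚ
increment k (suc d) = meanExcess k (suc d) ℚ.- meanExcess k d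

-- The products `e(e+1)` grow by `2(e+1)` from `e` to `e+1`. For `d < k` truncation makes every term
-- vanish.
excess-product : ∀ k d → (suc d ∸ k) ℕ.* suc (suc d ∸ k) ≡
  (suc d ∸ k) ℕ.+ (suc d ∸ k) ℕ.+ (d ∸ k) ℕ.* suc (d ∸ k)
excess-product k d with ℕₚ.≤-<-connex k d
... | inj₁ k≤d rewrite ℕₚ.+-∸-assoc 1 k≤d = identity (d ∸ k)
  where
  identity : ∀ e → suc e ℕ.* suc (suc e) ≡ suc e ℕ.+ suc e ℕ.+ e ℕ.* suc e
  identity = ℕSolver.solve-∀
... | inj₂ d<k rewrite ℕₚ.m≤n⇒m∸n≡0 d<k | ℕₚ.m≤n⇒m∸n≡0 (ℕₚ.<⇒≤ d<k) = ≡.refl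

-- The total of `b ∸ k` over `b ≤ d` is `d+1` times the mean, and its last summand `d ∸ k` is the
-- difference of two consecutive totals.
excess-split : ∀ k d → ratio (d ∸ k) ≡ meanExcess k d ℚ.+ ratio d ℚ.* increment k d
excess-split k zero rewrite ℕₚ.0∸n≡0 k = ≡.refl
excess-split k (suc d) = begin
  e′
    -- `½ ℚ.* ratio t` is the total of `b ∸ k` over `b ≤ d`; adding `e′` gives the total over
    -- `b ≤ suc d`.
    ≡⟨ solve 2 (λ e′ y → e′ := (e′ :+ y) :+ :- y) ≡.refl e′ (½ ℚ.* ratio t) ⟩
  (e′ ℚ.+ ½ ℚ.* ratio t) ℚ.- ½ ℚ.* ratio t
    ≡⟨ cong₂ ℚ._-_ half-sum (≡.sym (*-half-fraction t d)) ⟩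
  ½ ℚ.* (e′ ℚ.+ e′ ℚ.+ ratio t) ℚ.- n ℚ.* f
    ≡⟨ cong (λ z → ½ ℚ.* z ℚ.- n ℚ.* f) (≡.sym ratio-t′) ⟩
  ½ ℚ.* ratio t′ ℚ.- n ℚ.* f
    ≡⟨ cong (ℚ._- n ℚ.* f) (≡.sym (*-half-fraction t′ (suc d))) ⟩
  ratio (1 ℕ.+ suc d) ℚ.* f′ ℚ.- n ℚ.* f
    ≡⟨ cong (λ z → z ℚ.* f′ ℚ.- n ℚ.* f) (ratio-+ 1 (suc d)) ⟩
  (1ℚ ℚ.+ n) ℚ.* f′ ℚ.- n ℚ.* f
    ≡⟨ solve 3 (λ n f f′ → ((con 1ℚ :+ n) :* f′) :+ :- (n :* f) := f′ :+ n :* (f′ :+ :- f)) ≡.refl n f f′ ⟩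
  f′ ℚ.+ n ℚ.* (f′ ℚ.- f) ∎
  where
  open ≡.≡-Reasoning
  n  = ratio (suc d)
  e′ = ratio (suc d ∸ k)
  t  = (d ∸ k) ℕ.* suc (d ∸ k)
  t′ = (suc d ∸ k) ℕ.* suc (suc d ∸ k)
  f  = meanExcess k d
  f′ = meanExcess k (suc d)
  half-sum : e′ ℚ.+ ½ ℚ.* ratio t ≡ ½ ℚ.* (e′ ℚ.+ e′ ℚ.+ ratio t)
  half-sum = solve 2 (λ e y → e :+ con ½ :* y := con ½ :* (e :+ e :+ y)) ≡.refl e′ (ratio t)
  ratio-t′ : ratio t′ ≡ e′ ℚ.+ e′ ℚ.+ ratio t
  ratio-t′ = ≡.trans (cong ratio (excess-product k d))
    (≡.trans (ratio-+ ((suc d ∸ k) ℕ.+ (suc d ∸ k)) t)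
      (cong (ℚ._+ ratio t) (ratio-+ (suc d ∸ k) (suc d ∸ k))))

-- Finite sums, minima and thresholds over lists.

sumOver : ∀ {A : Set} → (A → ℚ) → List A → ℚ
sumOver f []       = 0ℚ
sumOver f (x ∷ xs) = f x ℚ.+ sumOver f xs

module _ {A : Set} where

  sumOver-↭ : ∀ (f : A → ℚ) {xs ys} → xs ↭ ys → sumOver f xs ≡ sumOver f ys
  sumOver-↭ f refl = ≡.refl
  sumOver-↭ f (prep x p) = cong (f x ℚ.+_) (sumOver-↭ f p)
  sumOver-↭ f (swap {ys = ys} x y p) = ≡.trans
    (cong (λ s → f x ℚ.+ (f y ℚ.+ s)) (sumOver-↭ f p))
    (solve 3 (λ a b s → a :+ (b :+ s) := b :+ (a :+ s)) ≡.refl (f x) (f y) (sumOver f ys))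
  sumOver-↭ f (trans p q) = ≡.trans (sumOver-↭ f p) (sumOver-↭ f q)

  sumOver-cong : ∀ {f g : A → ℚ} xs → (∀ {x} → x ∈ xs → f x ≡ g x) → sumOver f xs ≡ sumOver g xs
  sumOver-cong []       h = ≡.refl
  sumOver-cong (x ∷ xs) h = cong₂ ℚ._+_ (h (here ≡.refl)) (sumOver-cong xs (h ∘ there))

  sumOver-∷ʳ : ∀ (f : A → ℚ) xs y → sumOver f (xs ++ [ y ]) ≡ f y ℚ.+ sumOver f xs
  sumOver-∷ʳ f xs y = sumOver-↭ f (++-comm xs [ y ])

  -- Serves to add up the drop of the bound when a vertex is removed: `P` will be adjacency to that
  -- vertex and `q` its gain.
  count*+sumOver-≤ : ∀ {P : A → Set} (P? : ∀ x → Dec (P x)) q {f g : A → ℚ} xs →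
    (∀ {x} → x ∈ xs → P x → q ℚ.+ f x ℚ.≤ g x) →
    (∀ {x} → x ∈ xs → ¬ P x → f x ℚ.≤ g x) →
    ratio (length (filter P? xs)) ℚ.* q ℚ.+ sumOver f xs ℚ.≤ sumOver g xs
  count*+sumOver-≤ P? q [] h h′ = ℚₚ.≤-reflexive
    (≡.trans (ℚₚ.+-identityʳ (0ℚ ℚ.* q)) (ℚₚ.*-zeroˡ q))
  count*+sumOver-≤ P? q {f} {g} (x ∷ xs) h h′ with P? x
  ... | yes px = begin
      ratio (1 ℕ.+ n) ℚ.* q ℚ.+ (f x ℚ.+ sumOver f xs)
        ≡⟨ cong (λ r → r ℚ.* q ℚ.+ (f x ℚ.+ sumOver f xs)) (ratio-+ 1 n) ⟩
      (1ℚ ℚ.+ ratio n) ℚ.* q ℚ.+ (f x ℚ.+ sumOver f xs)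
        ≡⟨ solve 4 (λ r q a s → ((con 1ℚ :+ r) :* q) :+ (a :+ s) := (q :+ a) :+ (r :* q :+ s))
             ≡.refl (ratio n) q (f x) (sumOver f xs) ⟩
      (q ℚ.+ f x) ℚ.+ (ratio n ℚ.* q ℚ.+ sumOver f xs)
        ≤⟨ ℚₚ.+-mono-≤ (h (here ≡.refl) px) (count*+sumOver-≤ P? q xs (h ∘ there) (h′ ∘ there)) ⟩
      g x ℚ.+ sumOver g xs ∎
    where
    open ℚₚ.≤-Reasoning
    n = length (filter P? xs)
  ... | no ¬px = begin
      ratio n ℚ.* q ℚ.+ (f x ℚ.+ sumOver f xs)
        ≡⟨ solve 3 (λ r a s → r :+ (a :+ s) := a :+ (r :+ s))
             ≡.refl (ratio n ℚ.* q) (f x) (sumOver f xs) ⟩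
      f x ℚ.+ (ratio n ℚ.* q ℚ.+ sumOver f xs)
        ≤⟨ ℚₚ.+-mono-≤ (h′ (here ≡.refl) ¬px) (count*+sumOver-≤ P? q xs (h ∘ there) (h′ ∘ there)) ⟩
      g x ℚ.+ sumOver g xs ∎
    where
    open ℚₚ.≤-Reasoning
    n = length (filter P? xs)

  extractMinimum : ∀ (g : A → ℚ) x xs →
    ∃₂ λ v ys → (x ∷ xs ↭ v ∷ ys) × (∀ {u} → u ∈ ys → g v ℚ.≤ g u)
  extractMinimum g x [] = x , [] , ↭-refl , λ ()
  extractMinimum g x (y ∷ xs) with extractMinimum g y xs
  ... | v , ys , p , v≤ with ℚₚ.≤-total (g x) (g v)
  ...   | inj₁ x≤v = x , v ∷ ys , prep x p , λ where
          (here ≡.refl) → x≤v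
          (there u∈)    → ℚₚ.≤-trans x≤v (v≤ u∈)
  ...   | inj₂ v≤x = v , x ∷ ys , trans (prep x p) (swap x v ↭-refl) , λ where
          (here ≡.refl) → v≤x
          (there u∈)    → v≤ u∈

  Unique-resp-↭ : ∀ {xs ys : List A} → xs ↭ ys → Unique xs → Unique ys
  Unique-resp-↭ p = Permₛ.Unique-resp-↭ (setoid A) (↭⇒↭ₛ p)

  -- The maximum of finitely many thresholds works for all entries.
  eventually-all : ∀ {P : A → ℕ → Set} xs →
    (∀ {x} → x ∈ xs → ∃ λ N → ∀ n → N ℕ.≤ n → P x n) →
    ∃ λ N → ∀ n → N ℕ.≤ n → ∀ {x} → x ∈ xs → P x n
  eventually-all []       h = 0 , λ _ _ ()
  eventually-all (x ∷ xs) h =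
    let N₁ , h₁ = h (here ≡.refl)
        N₂ , h₂ = eventually-all xs (h ∘ there)
    in N₁ ℕ.⊔ N₂ , λ n N≤n → λ where
      (here ≡.refl) → h₁ n (ℕₚ.m⊔n≤o⇒m≤o N₁ N₂ N≤n)
      (there x∈)    → h₂ n (ℕₚ.m⊔n≤o⇒n≤o N₁ N₂ N≤n) x∈

-- Predecessors of a vertex in an ordering.

before : ∀ {n} → Fin n → List (Fin n) → List (Fin n)
before u = takeWhile (λ v → ¬? (u Finₚ.≟ v))

before-∈ : ∀ {n} {u : Fin n} us {vs} → u ∈ us → before u (us ++ vs) ≡ before u us
before-∈ {u = u} (x ∷ us) u∈ with u Finₚ.≟ x
... | yes _ = ≡.refl
before-∈ (x ∷ us) (here u≡x) | no u≢x = contradiction u≡x u≢x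
before-∈ (x ∷ us) (there u∈) | no _   = cong (x ∷_) (before-∈ us u∈)

before-∉ : ∀ {n} {u : Fin n} us {vs} → u ∉ us → before u (us ++ u ∷ vs) ≡ us
before-∉ {u = u} [] u∉ with u Finₚ.≟ u
... | yes _  = ≡.refl
... | no u≢u = contradiction ≡.refl u≢u
before-∉ {u = u} (x ∷ us) u∉ with u Finₚ.≟ x
... | yes u≡x = contradiction (here u≡x) u∉
... | no _    = cong (x ∷_) (before-∉ us (u∉ ∘ there))

-- Predecessors taken by vertex are stable under appending, which suits the induction; this leads
-- back to the positions used by `BackDegreesBoundedBy`.
before-lookup : ∀ {n} {us : List (Fin n)} → Unique us → ∀ i →
  before (lookup us i) us ≡ take (toℕ i) us
before-lookup {us = x ∷ us} _ zero with x Finₚ.≟ x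
... | yes _  = ≡.refl
... | no x≢x = contradiction ≡.refl x≢x
before-lookup {us = x ∷ us} (x∉ ∷ uniq) (suc i) with lookup us i Finₚ.≟ x
... | yes eq = contradiction (≡.sym eq) (All.lookup x∉ (∈-lookup i))
... | no _   = cong (x ∷_) (before-lookup uniq i)

-- The greedy ordering for rational weights.

module _ (G : SimpleGraph) where
  open SimpleGraph G hiding (V; deg)

  degIn : V G → List (V G) → ℕ
  degIn u xs = length (neighborsIn u xs)

  degIn-↭ : ∀ u {xs ys} → xs ↭ ys → degIn u xs ≡ degIn u ys
  degIn-↭ u p = ↭-length (filter-↭ (u ~?_) p)

  degIn-adjacent : ∀ {u v} xs → u ~ v → degIn u (v ∷ xs) ≡ suc (degIn u xs)
  degIn-adjacent {u} xs u~v = cong length (Listₚ.filter-accept (u ~?_) u~v)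

  degIn-nonadjacent : ∀ {u v} xs → ¬ u ~ v → degIn u (v ∷ xs) ≡ degIn u xs
  degIn-nonadjacent {u} xs u≁v = cong length (Listₚ.filter-reject (u ~?_) u≁v)

  backDegree : List (V G) → V G → ℕ
  backDegree us u = degIn u (before u us)

  module _ (w : V G → ℚ) (k : V G → ℕ) where

    -- The weighted cost of the least increment that the ordering `us` requires at `u`.
    excessTerm : List (V G) → V G → ℚ
    excessTerm us u = w u ℚ.* ratio (backDegree us u ∸ k u)

    meanTerm : List (V G) → V G → ℚ
    meanTerm xs u = w u ℚ.* meanExcess (k u) (degIn u xs)

    -- The function `g` that the greedy rule minimises.
    gain : List (V G) → V G → ℚ
    gain xs u = w u ℚ.* increment (k u) (degIn u xs)

    -- The appended vertex has all of `us` before it, and the other vertices keep their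
    -- predecessors.
    excessTerm-∷ʳ : ∀ us v → v ∉ us → sumOver (excessTerm (us ++ [ v ])) (us ++ [ v ]) ≡
      w v ℚ.* ratio (degIn v us ∸ k v) ℚ.+ sumOver (excessTerm us) us
    excessTerm-∷ʳ us v v∉ = ≡.trans (sumOver-∷ʳ (excessTerm (us ++ [ v ])) us v) (cong₂ ℚ._+_
      (cong (λ l → w v ℚ.* ratio (degIn v l ∸ k v)) (before-∉ us v∉))
      (sumOver-cong us λ {u} u∈ →
        cong (λ l → w u ℚ.* ratio (degIn u l ∸ k u)) (before-∈ us u∈)))

    -- By `excess-split`, placing `v` last costs its mean term plus one copy of its gain per
    -- neighbour. Deleting `v` lowers the mean term of each neighbour by that neighbour's own gain,
    -- which is at least the gain of `v`.
    remove-minimum : ∀ v ys → (∀ {u} → u ∈ ys → gain (v ∷ ys) v ℚ.≤ gain (v ∷ ys) u) →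
      w v ℚ.* ratio (degIn v ys ∸ k v) ℚ.+ sumOver (meanTerm ys) ys ℚ.≤
      sumOver (meanTerm (v ∷ ys)) (v ∷ ys)
    remove-minimum v ys v≤ = begin
      w v ℚ.* ratio (D ∸ k v) ℚ.+ S
        ≡⟨ cong (λ r → w v ℚ.* r ℚ.+ S) (excess-split (k v) D) ⟩
      w v ℚ.* (F ℚ.+ ratio D ℚ.* increment (k v) D) ℚ.+ S
        ≡⟨ regroup (w v) F (ratio D) (increment (k v) D) S ⟩
      w v ℚ.* F ℚ.+ (ratio D ℚ.* (w v ℚ.* increment (k v) D) ℚ.+ S)
        -- There are no loops, so `v` has the same degree in `v ∷ ys` as in `ys`.
        ≡⟨ cong (λ d → w v ℚ.* meanExcess (k v) d ℚ.+
                       (ratio D ℚ.* (w v ℚ.* increment (k v) d) ℚ.+ S))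
             (degIn-nonadjacent ys ~-irrefl) ⟨
      meanTerm (v ∷ ys) v ℚ.+ (ratio D ℚ.* gain (v ∷ ys) v ℚ.+ S)
        ≤⟨ ℚₚ.+-monoʳ-≤ (meanTerm (v ∷ ys) v)
             (count*+sumOver-≤ (v ~?_) (gain (v ∷ ys) v) ys adjacent nonadjacent) ⟩
      sumOver (meanTerm (v ∷ ys)) (v ∷ ys) ∎
      where
      open ℚₚ.≤-Reasoning
      D = degIn v ys
      F = meanExcess (k v) D
      S = sumOver (meanTerm ys) ys

      regroup : ∀ w f d i s →
        w ℚ.* (f ℚ.+ d ℚ.* i) ℚ.+ s ≡ w ℚ.* f ℚ.+ (d ℚ.* (w ℚ.* i) ℚ.+ s)
      regroup = solve 5 (λ w f d i s →
        (w :* (f :+ d :* i)) :+ s := (w :* f) :+ (d :* (w :* i) :+ s)) ≡.refl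

      telescope : ∀ w f′ f → w ℚ.* (f′ ℚ.- f) ℚ.+ w ℚ.* f ≡ w ℚ.* f′
      telescope = solve 3 (λ w f′ f → (w :* (f′ :+ :- f)) :+ (w :* f) := w :* f′) ≡.refl

      -- The degree of `u` in `v ∷ ys` is a successor, so its increment is a genuine difference and
      -- not the default.
      gain-adjacent : ∀ {u} → v ~ u → gain (v ∷ ys) u ℚ.+ meanTerm ys u ≡ meanTerm (v ∷ ys) u
      gain-adjacent {u} v~u = subst
        (λ d → w u ℚ.* increment (k u) d ℚ.+ meanTerm ys u ≡ w u ℚ.* meanExcess (k u) d)
        (≡.sym (degIn-adjacent ys (~-sym v~u)))
        (telescope (w u) (meanExcess (k u) (suc (degIn u ys))) (meanExcess (k u) (degIn u ys)))

      adjacent : ∀ {u} → u ∈ ys → v ~ u → gain (v ∷ ys) v ℚ.+ meanTerm ys u ℚ.≤ meanTerm (v ∷ ys) u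
      adjacent {u} u∈ v~u = ℚₚ.≤-trans (ℚₚ.+-monoˡ-≤ (meanTerm ys u) (v≤ u∈))
        (ℚₚ.≤-reflexive (gain-adjacent v~u))

      nonadjacent : ∀ {u} → u ∈ ys → ¬ v ~ u → meanTerm ys u ℚ.≤ meanTerm (v ∷ ys) u
      nonadjacent {u} _ v≁u = ℚₚ.≤-reflexive
        (cong (λ d → w u ℚ.* meanExcess (k u) d) (≡.sym (degIn-nonadjacent ys (v≁u ∘ ~-sym))))

    -- The inductive step of the greedy construction: degrees depend on a list only up to
    -- permutation, so `remove-minimum` transfers to `xs` and `us`.
    append-minimum : ∀ {xs} v ys us → xs ↭ v ∷ ys → (∀ {u} → u ∈ ys → gain xs v ℚ.≤ gain xs u) →
      All (v ≢_) ys → us ↭ ys → sumOver (excessTerm us) us ℚ.≤ sumOver (meanTerm ys) ys →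
      sumOver (excessTerm (us ++ [ v ])) (us ++ [ v ]) ℚ.≤ sumOver (meanTerm xs) xs
    append-minimum {xs} v ys us p v≤ v∉ys q us≤ = begin
      sumOver (excessTerm (us ++ [ v ])) (us ++ [ v ])
        ≡⟨ excessTerm-∷ʳ us v (λ v∈ → All.lookup v∉ys (∈-resp-↭ q v∈) ≡.refl) ⟩
      w v ℚ.* ratio (degIn v us ∸ k v) ℚ.+ sumOver (excessTerm us) us
        ≡⟨ cong (λ d → w v ℚ.* ratio (d ∸ k v) ℚ.+ sumOver (excessTerm us) us) (degIn-↭ v q) ⟩
      w v ℚ.* ratio (degIn v ys ∸ k v) ℚ.+ sumOver (excessTerm us) us
        ≤⟨ ℚₚ.+-monoʳ-≤ (w v ℚ.* ratio (degIn v ys ∸ k v)) us≤ ⟩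
      w v ℚ.* ratio (degIn v ys ∸ k v) ℚ.+ sumOver (meanTerm ys) ys
        ≤⟨ remove-minimum v ys (λ {u} u∈ → ≡.subst₂ ℚ._≤_ (gain-≡ v) (gain-≡ u) (v≤ u∈)) ⟩
      sumOver (meanTerm (v ∷ ys)) (v ∷ ys)
        ≡⟨ sumOver-↭ (meanTerm (v ∷ ys)) p ⟨
      sumOver (meanTerm (v ∷ ys)) xs
        ≡⟨ sumOver-cong xs (λ {u} _ → cong (λ d → w u ℚ.* meanExcess (k u) d) (degIn-↭ u p)) ⟨
      sumOver (meanTerm xs) xs ∎
      where
      open ℚₚ.≤-Reasoning
      gain-≡ : ∀ u → gain xs u ≡ gain (v ∷ ys) u
      gain-≡ u = cong (λ d → w u ℚ.* increment (k u) d) (degIn-↭ u p)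

    -- The recursion is on the length `m`, because `ys` comes from a permutation of `xs` and is not
    -- structurally smaller.
    greedyOrdering : ∀ m xs → length xs ≡ m → Unique xs → ∃ λ us → us ↭ xs ×
      sumOver (excessTerm us) us ℚ.≤ sumOver (meanTerm xs) xs
    greedyOrdering _       []           _      _    = [] , ↭-refl , ℚₚ.≤-refl
    greedyOrdering (suc m) xs@(x ∷ xs′) length≡ uniq =
      let v , ys , p , v≤ = extractMinimum (gain xs) x xs′
          uniq-v∷ys       = Unique-resp-↭ p uniq
          length-ys≡m     = ℕₚ.suc-injective (≡.trans (↭-length (↭-sym p)) length≡)
          us , q , us≤    = greedyOrdering m ys length-ys≡m (AllPairs.tail uniq-v∷ys)
      in us ++ [ v ]
       , trans (++-comm us [ v ]) (trans (prep v q) (↭-sym p))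
       , append-minimum v ys us p v≤ (AllPairs.head uniq-v∷ys) q us≤

  -- Linear orderings of all vertices and their feasible increments.

  open DecMembership (Finₚ._≟_ {order}) using (_∈?_)
  open DecUnique (Finₚ._≟_ {order}) using (unique?)

  isLinearOrdering? : ∀ us → Dec (IsLinearOrderingOf G ⊤ us)
  isLinearOrdering? us = unique? us ×-dec Finₚ.all? λ v → map′
    (λ v∈ → mk⇔ (λ _ → ∈⊤) (λ _ → v∈)) (λ e → Equivalence.from e ∈⊤) (v ∈? us)

  -- No ordering is missed, since a list of distinct vertices has at most `order` entries.
  linearOrderings : List (List (V G))
  linearOrderings = filter isLinearOrdering? (listsUpTo (allFin order) order)

  ∈-linearOrderings : ∀ {us} → IsLinearOrderingOf G ⊤ us → us ∈ linearOrderings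
  ∈-linearOrderings {us} ord = ∈-filter⁺ isLinearOrdering?
    (∈-listsUpTo (allFin order) ∈-allFin order us (Unique⇒length≤ (proj₁ ord))) ord

  ↭-allFin⇒isLinearOrdering : ∀ {us} → us ↭ allFin order → IsLinearOrderingOf G ⊤ us
  ↭-allFin⇒isLinearOrdering p = Unique-resp-↭ (↭-sym p) (Uniqueₚ.allFin⁺ order)
    , λ v → mk⇔ (λ _ → ∈⊤) (λ _ → ∈-resp-↭ (↭-sym p) (∈-allFin v))

  -- With `b` the back degree of `u`, this is `b ≤ k u + (b ∸ k u)` followed by `k u ≤ κ u`.
  excess-degenerate : ∀ {us} {k : V G → ℕ} {κ : V G → ℤ} → (∀ u → + k u ≤ κ u) → IsLinearOrderingOf G ⊤ us →
    IsDegenerate G (λ u → κ u + + (backDegree us u ∸ k u)) ⊤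
  excess-degenerate {us} {k} {κ} k≤κ ord = us , ord , λ i →
    let u = lookup us i in ℤₚ.≤-trans
      (ℤ.+≤+ (subst (λ l → degIn u l ℕ.≤ k u ℕ.+ (backDegree us u ∸ k u))
        (before-lookup (proj₁ ord) i) (ℕₚ.m≤n+m∸n (backDegree us u) (k u))))
      (ℤₚ.+-monoˡ-≤ (+ (backDegree us u ∸ k u)) (k≤κ u))

-- Passage from rational approximants to real costs.

sumOver-tabulate : ∀ {A : Set} {m} (f : Fin m → ℝ) n (F : A → ℚ) (a : Fin m → A) →
  (∀ i → seq (f i) n ≡ F (a i)) → seq (sumʳ f) n ≡ sumOver F (tabulate a)
sumOver-tabulate {m = zero}  f n F a h = ≡.refl
sumOver-tabulate {m = suc m} f n F a h =
  -- The tail of `tabulate a` is tabulated by `a ∘ suc`, which is why the induction keeps `a`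
  -- arbitrary.
  cong₂ ℚ._+_ (h zero) (sumOver-tabulate (f ∘ suc) n F (a ∘ suc) (h ∘ suc))

seq-sumʳ : ∀ {m} (f : Fin m → ℝ) n → seq (sumʳ f) n ≡ sumOver (λ i → seq (f i) n) (allFin m)
seq-sumʳ f n = sumOver-tabulate f n (λ i → seq (f i) n) (λ i → i) (λ _ → ≡.refl)

module _ (G : SimpleGraph) (c : V G → ℝ⁺) (k : V G → ℕ) where
  open SimpleGraph G using (order)

  excess : List (V G) → V G → ℕ
  excess us u = backDegree G us u ∸ k u

  meanCost : V G → ℝ
  meanCost u = proj₁ (c u) *ʳ fromℚ (meanExcess (k u) (deg G u))

  approximant : ℕ → V G → ℚ
  approximant n u = seq (proj₁ (c u)) n

  -- Real sums and products are computed index by index, so the `n`-th approximant of the cost is a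
  -- rational cost with weights `approximant n`.
  seq-cost : ∀ n us → us ↭ allFin order →
    seq (cost G c (excess us)) n ≡ sumOver (excessTerm G (approximant n) k us) us
  seq-cost n us p = ≡.trans (seq-sumʳ (λ u → proj₁ (c u) *ʳ fromℕ (excess us u)) n)
    (≡.sym (sumOver-↭ (excessTerm G (approximant n) k us) p))

  seq-meanCost : ∀ n →
    seq (sumʳ meanCost) n ≡ sumOver (meanTerm G (approximant n) k (allFin order)) (allFin order)
  seq-meanCost n = seq-sumʳ meanCost n

  -- The ordering may change with `n`; none is singled out for the real costs themselves.
  cheapOrdering : ∀ n → ∃ λ us → us ∈ linearOrderings G ×
    seq (cost G c (excess us)) n ℚ.≤ seq (sumʳ meanCost) n
  cheapOrdering n =
    let us , p , us≤ = greedyOrdering G (approximant n) k _ (allFin order) ≡.refl (Uniqueₚ.allFin⁺ order)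
    in us , ∈-linearOrderings G (↭-allFin⇒isLinearOrdering G p)
     , ≡.subst₂ ℚ._≤_ (≡.sym (seq-cost n us p)) (≡.sym (seq-meanCost n)) us≤

  module _ {κ : V G → ℤ} (k≤κ : ∀ u → + k u ≤ κ u) where

    β≤cost : ∀ us → us ∈ linearOrderings G → β G c κ ≤ʳ cost G c (excess us)
    β≤cost us us∈ = proj₂ (β-isMinimum G c κ) x
      (excess us
      , excess-degenerate G k≤κ (proj₂ (∈-filter⁻ (isLinearOrdering? G) {xs = listsUpTo (allFin order) order} us∈))
      , ≤ʳ-refl {x} , ≤ʳ-refl {x})
      where x = cost G c (excess us)

    β≤meanCost : β G c κ ≤ʳ sumʳ meanCost
    β≤meanCost ε ε>0 =
      -- `N` has to be fixed for all orderings at once, because `cheapOrdering` picks its ordering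
      -- only after `n` is given.
      let N , β≤ = eventually-all {P = λ us n → seq (β G c κ) n ℚ.≤ seq (cost G c (excess us)) n ℚ.+ ε}
                     (linearOrderings G) (λ {us} us∈ → β≤cost us us∈ ε ε>0)
      in N , λ n N≤n →
        let us , us∈ , us≤ = cheapOrdering n
        in ℚₚ.≤-trans (β≤ n N≤n us∈) (ℚₚ.+-monoˡ-≤ ε us≤)

-- Integer thresholds and the closed form of the bound.

theorem1 : (G : SimpleGraph) (c : V G → ℝ⁺) (κ : V G → ℤ) →
    (∀ u → 0ℤ ≤ κ u × κ u ≤ + deg G u) →
    β G c κ ≤ʳ sumʳ (λ u → proj₁ (c u) *ʳ fromℚ (((+ deg G u - κ u) * (+ deg G u - κ u + 1ℤ)) / (2 ℕ.* suc (deg G u))))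
theorem1 G c κ h = ≤ʳ-trans {β G c κ} {sumʳ (meanCost G c k)} {sumʳ bound}
  (β≤meanCost G c k (λ u → ℤₚ.≤-reflexive (k≡κ u)))
  (sumʳ-mono-≤ {f = meanCost G c k} {bound} λ u → *ʳ-monoˡ-≤ (c u)
    (ℚₚ.≤-reflexive (cong (λ z → z / (2 ℕ.* suc (deg G u))) (numerator u))))
  where
  -- Since `κ u` is nonnegative, its absolute value is the same number as a natural.
  k : V G → ℕ
  k u = ℤ.∣ κ u ∣

  k≡κ : ∀ u → + k u ≡ κ u
  k≡κ u = ℤₚ.0≤i⇒+∣i∣≡i (proj₁ (h u))

  bound : V G → ℝ
  bound u = proj₁ (c u) *ʳ fromℚ (((+ deg G u - κ u) * (+ deg G u - κ u + 1ℤ)) / (2 ℕ.* suc (deg G u)))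

  -- Truncated subtraction is exact here because `κ u` is at most the degree.
  difference : ∀ u → + (deg G u ∸ k u) ≡ + deg G u - κ u
  difference u = begin
    + (deg G u ∸ k u)   ≡⟨ ℤₚ.⊖-≥ (ℤₚ.drop‿+≤+ (subst (_≤ + deg G u) (≡.sym (k≡κ u)) (proj₂ (h u)))) ⟨
    deg G u ℤ.⊖ k u     ≡⟨ ℤₚ.m-n≡m⊖n (deg G u) (k u) ⟨
    + deg G u - + k u   ≡⟨ cong (+ deg G u -_) (k≡κ u) ⟩
    + deg G u - κ u     ∎
    where open ≡.≡-Reasoning

  numerator : ∀ u → + ((deg G u ∸ k u) ℕ.* suc (deg G u ∸ k u)) ≡
    (+ deg G u - κ u) * (+ deg G u - κ u + 1ℤ)
  numerator u = begin
    + (e ℕ.* suc e)     ≡⟨ ℤₚ.pos-* e (suc e) ⟩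
    + e * + suc e       ≡⟨ cong (λ m → + e * + m) (ℕₚ.+-comm 1 e) ⟩
    + e * (+ e + 1ℤ)    ≡⟨ cong (λ z → z * (z + 1ℤ)) (difference u) ⟩
    (+ deg G u - κ u) * (+ deg G u - κ u + 1ℤ) ∎
    where
    open ≡.≡-Reasoning
    e = deg G u ∸ k u
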